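{- For a finite simple graph $G$ the following statements are equivalent: (1) $G$ is a bipartite elementary graph. (2) $G$ has edge-chromatic index at most $2$. (3) $G$ admits a $\{{}^rP_3,{}^bP_3,{}^rK_3,{}^bK_3,{}^{rrb}K_3,{}^{rbb}K_3\}$-free $2$-edge-colouring.
   Context: Graphs are finite and simple. A $2$-edge-colouring of $G$ assigns to every edge the colour red or blue (not necessarily properly). For a set $\mathcal F$ of $2$-edge-coloured graphs, a $2$-edge-colouring of $G$ is $\mathcal F$-free if no induced $2$-edge-coloured subgraph is isomorphic (preserving colours) to a member of $\mathcal F$. Patterns on three vertices: ${}^rP_3$ (resp. ${}^bP_3$) is the path on three vertices with both edges red (resp. blue); ${}^rK_3$ (resp. ${}^bK_3$) is the triangle with all edges red (resp. blue); ${}^{rrb}K_3$ is the triangle with two red and one blue edge; ${}^{rbb}K_3$ is the triangle with one red and two blue edges. A graph is elementary if it admits a $\{{}^rP_3,{}^bP_3\}$-free $2$-edge-colouring. The edge-chromatic index is the least number of colours in a proper edge-colouring. -}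

module Defs where

open import Level using (0ℓ)
open import Data.Bool.Base using (Bool)
open import Data.Fin.Base using (Fin; toℕ)
import Data.Fin.Properties as Fin
open import Data.Fin.Subset using (Subset; _∈_)
open import Data.List.Base using (List; []; _∷_)
open import Data.List.Relation.Unary.All using (All)
open import Data.Nat.Base using (ℕ; _+_; _≤_; ∣_-_∣)
import Data.Nat.Properties as ℕ
open import Data.Product.Base using (∃; _×_; _,_; proj₁)
open import Function.Bundles using (_↔_; _⇔_; module Inverse)
open import Relation.Binary.Core using (Rel)
open import Relation.Binary.Definitions using (Decidable; Irreflexive; Symmetric)
open import Relation.Binary.PropositionalEquality
  using (_≡_; _≢_; refl; sym; trans; cong; ≢-sym)
open import Relation.Nullary using (¬_; ¬?)

record Graph (V : Set) : Set₁ where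
  field
    _~_      : Rel V 0ℓ
    ~-sym    : Symmetric _~_
    ~-irrefl : Irreflexive _≡_ _~_
    _~?_     : Decidable _~_

-- Since `colour-sym` quantifies over all adjacency proofs on both sides, the
-- colour depends only on the unordered pair of endpoints, not on the proof.
record EdgeColouring {V : Set} (G : Graph V) (C : Set) : Set where
  open Graph G
  field
    colour     : ∀ {u v} → u ~ v → C
    colour-sym : ∀ {u v} (e : u ~ v) (e′ : v ~ u) → colour e ≡ colour e′

data Colour : Set where
  red blue : Colour

record ColouredGraph (V : Set) : Set₁ where
  constructor _,_
  field
    graph     : Graph V
    colouring : EdgeColouring graph Colour
  open Graph graph public
  open EdgeColouring colouring public

record _≅_ {V W : Set} (G : ColouredGraph V) (H : ColouredGraph W) : Set where
  private
    module G = ColouredGraph G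
    module H = ColouredGraph H
  field
    bijection : V ↔ W
  open Inverse bijection using (to)
  field
    preserves-~      : ∀ u v → (u G.~ v) ⇔ (to u H.~ to v)
    preserves-colour : ∀ {u v} (e : u G.~ v) (e′ : to u H.~ to v) →
                       G.colour e ≡ H.colour e′

induced : ∀ {n} → ColouredGraph (Fin n) → (S : Subset n) →
          ColouredGraph (∃ λ v → v ∈ S)
induced G S = record
  { graph = record
    { _~_      = λ u v → proj₁ u ~ proj₁ v
    ; ~-sym    = ~-sym
    ; ~-irrefl = λ u≡v → ~-irrefl (cong proj₁ u≡v)
    ; _~?_     = λ u v → proj₁ u ~? proj₁ v
    }
  ; colouring = record { colour = colour ; colour-sym = colour-sym }
  }
  where open ColouredGraph G

Pattern : Set₁
Pattern = ∃ λ k → ColouredGraph (Fin k)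

Free : ∀ {n} → List Pattern → ColouredGraph (Fin n) → Set₁
Free F G = All (λ (_ , H) → ¬ ∃ λ S → induced G S ≅ H) F

AdmitsFree : ∀ {n} → List Pattern → Graph (Fin n) → Set₁
AdmitsFree F G = ∃ λ (c : EdgeColouring G Colour) → Free F (G , c)

path₃ : Graph (Fin 3)
path₃ = record
  { _~_      = λ u v → ∣ toℕ u - toℕ v ∣ ≡ 1
  ; ~-sym    = λ {u} {v} e → trans (ℕ.∣-∣-comm (toℕ v) (toℕ u)) e
  ; ~-irrefl = λ { {u} refl e → ℕ.0≢1+n (trans (sym (ℕ.∣n-n∣≡0 (toℕ u))) e) }
  ; _~?_     = λ u v → ∣ toℕ u - toℕ v ∣ ℕ.≟ 1
  }

triangle : Graph (Fin 3)
triangle = record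
  { _~_      = _≢_
  ; ~-sym    = ≢-sym
  ; ~-irrefl = λ u≡v u≢v → u≢v u≡v
  ; _~?_     = λ u v → ¬? (u Fin.≟ v)
  }

P₃ : Colour → Pattern
P₃ a = 3 , (path₃ , record { colour = λ _ → a ; colour-sym = λ _ _ → refl })

-- `K₃ a b c` colours 01 with a, 02 with b and 12 with c; an edge of the
-- triangle is determined by the sum of its endpoints.
K₃ : Colour → Colour → Colour → Pattern
K₃ a b c = 3 , (triangle , record
  { colour     = λ {u} {v} _ → select (toℕ u + toℕ v)
  ; colour-sym = λ {u} {v} _ _ → cong select (ℕ.+-comm (toℕ u) (toℕ v))
  })
  where
  select : ℕ → Colour
  select 1 = a
  select 2 = b
  select _ = c

ʳP₃ ᵇP₃ ʳK₃ ᵇK₃ ʳʳᵇK₃ ʳᵇᵇK₃ : Pattern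
ʳP₃   = P₃ red
ᵇP₃   = P₃ blue
ʳK₃   = K₃ red red red
ᵇK₃   = K₃ blue blue blue
ʳʳᵇK₃ = K₃ red red blue
ʳᵇᵇK₃ = K₃ red blue blue

Elementary : ∀ {n} → Graph (Fin n) → Set₁
Elementary = AdmitsFree (ʳP₃ ∷ ᵇP₃ ∷ [])

Bipartite : ∀ {V} → Graph V → Set
Bipartite {V} G = ∃ λ (side : V → Bool) → ∀ {u v} → u ~ v → side u ≢ side v
  where open Graph G

Proper : ∀ {V C} {G : Graph V} → EdgeColouring G C → Set
Proper {G = G} c =
  ∀ {u v w} (e : u ~ v) (e′ : u ~ w) → v ≢ w → colour e ≢ colour e′
  where
  open Graph G
  open EdgeColouring c

ProperlyEdgeColourable : ∀ {V} → Graph V → ℕ → Set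
ProperlyEdgeColourable G k = ∃ λ (c : EdgeColouring G (Fin k)) → Proper c

IsEdgeChromaticIndex : ∀ {V} → Graph V → ℕ → Set
IsEdgeChromaticIndex G k =
  ProperlyEdgeColourable G k × (∀ m → ProperlyEdgeColourable G m → k ≤ m)

EdgeChromaticIndexAtMost : ∀ {V} → Graph V → ℕ → Set
EdgeChromaticIndexAtMost G m = ∃ λ k → IsEdgeChromaticIndex G k × k ≤ m

{-# OPTIONS --safe #-}
-- A colouring is free of the six patterns exactly when it is a proper
-- edge-colouring: two edges of the same colour at a vertex span either a
-- monochromatic path or a triangle, and every 2-coloured triangle has two edges
-- of the same colour.  In a bipartite graph there are no triangles, so the two
-- path patterns suffice.  Conversely a properly 2-edge-coloured graph has no
-- closed walk of odd length: cancelling consecutive edges of the same colour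
-- makes the walk alternating; if its length is odd, then its first and last
-- edges have the same colour, so if it is closed they coincide and can be
-- stripped, until a single edge is left.  The parity of walks to a chosen root
-- of each component is then a bipartition.
module Submission where

open import Defs
open import Data.Bool.Base using (Bool; true; false; not; _xor_)
open import Data.Bool.Properties using (not-distribˡ-xor; not-distribʳ-xor)
open import Data.Empty using (⊥)
open import Data.Fin.Base using (Fin; inject≤)
open import Data.Fin.Patterns using (0F; 1F; 2F)
open import Data.Fin.Properties using (_≟_; any?; inject≤-injective)
open import Data.Fin.Subset using (Subset; _∈_)
open import Data.List.Base using (List; []; _∷_; allFin; cartesianProduct)
open import Data.List.Membership.Propositional.Properties
  using (∈-allFin; ∈-cartesianProduct⁺)
open import Data.List.Relation.Unary.All as All using (All; []; _∷_)
open import Data.Nat.Base using (ℕ; _≤_; z≤n; s≤s)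
open import Data.Nat.Properties using (≤-refl)
open import Data.Product.Base using (∃; _×_; _,_; proj₁; proj₂)
open import Data.Vec.Base using (tabulate)
open import Data.Vec.Properties using ([]=⇒lookup; lookup⇒[]=; lookup∘tabulate)
open import Data.Vec.Properties.WithK using ([]=-irrelevant)
open import Function.Base using (_∘_; id; case_of_)
open import Function.Bundles using (_⇔_; mk⇔; mk↔ₛ′; module Equivalence; module Inverse)
open import Function.Definitions using (Injective)
open import Relation.Binary.Construct.Closure.ReflexiveTransitive
  using (Star; ε; _◅_; _◅◅_; reverse)
open import Relation.Binary.PropositionalEquality
  using (_≡_; _≢_; refl; sym; trans; cong; subst; subst₂)
open import Relation.Nullary using (¬_; Dec; yes; no; does; contradiction; ¬?; _×-dec_)
open import Relation.Nullary.Decidable using (dec-true)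

-- The two colours

opposite : Colour → Colour
opposite red  = blue
opposite blue = red

opposite-involutive : ∀ c → opposite (opposite c) ≡ c
opposite-involutive red  = refl
opposite-involutive blue = refl

-- A view instead of a decidable equality: in the second case, matching replaces the other colour by
-- `opposite a`, the form in which alternating walks mention it.
data Compare (a : Colour) : Colour → Set where
  same     : Compare a a
  opposing : Compare a (opposite a)

compare : ∀ a b → Compare a b
compare red  red  = same
compare red  blue = opposing
compare blue red  = opposing
compare blue blue = same

-- Edges of a given colour

module _ {V C : Set} {G : Graph V} (γ : EdgeColouring G C) where
  open Graph G
  open EdgeColouring γ

  Edge : C → V → V → Set
  Edge a u v = ∃ λ (e : u ~ v) → colour e ≡ a

  -- Both proofs are compared with the same proof of the reversed adjacency.
  colour-irrelevant : ∀ {u v} (e e′ : u ~ v) → colour e ≡ colour e′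
  colour-irrelevant e e′ =
    trans (colour-sym e (~-sym e)) (sym (colour-sym e′ (~-sym e)))

  Edge-sym : ∀ {a u v} → Edge a u v → Edge a v u
  Edge-sym (e , refl) = ~-sym e , sym (colour-sym e (~-sym e))

  colour-subst₂ : ∀ {u u′ v v′} (p : u ≡ u′) (q : v ≡ v′) (e : u ~ v) →
                  colour (subst₂ _~_ p q e) ≡ colour e
  colour-subst₂ refl refl e = refl

recolour : ∀ {V C D : Set} {G : Graph V} → (C → D) → EdgeColouring G C → EdgeColouring G D
recolour f γ = record
  { colour     = f ∘ colour
  ; colour-sym = λ e e′ → cong f (colour-sym e e′)
  }
  where open EdgeColouring γ

recolour-proper : ∀ {V C D : Set} {G : Graph V} {f : C → D} (γ : EdgeColouring G C) →
                  Injective _≡_ _≡_ f → Proper γ → Proper (recolour f γ)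
recolour-proper γ inj proper e e′ v≢w eq = proper e e′ v≢w (inj eq)

P₃s allPatterns : List Pattern
P₃s         = ʳP₃ ∷ ᵇP₃ ∷ []
allPatterns = ʳP₃ ∷ ᵇP₃ ∷ ʳK₃ ∷ ᵇK₃ ∷ ʳʳᵇK₃ ∷ ʳᵇᵇK₃ ∷ []

-- Induced patterns

proj₁-injective : ∀ {n} {S : Subset n} {p q : ∃ λ v → v ∈ S} → proj₁ p ≡ proj₁ q → p ≡ q
proj₁-injective {p = _ , p} {_ , q} refl = cong (_ ,_) ([]=-irrelevant p q)

module _ {n} {G : Graph (Fin n)} {γ : EdgeColouring G Colour} where
  open Graph G
  open EdgeColouring γ

  -- The inverse of the isomorphism carries two equally coloured edges at a vertex of `H` to such a
  -- pair in `G`, and injectivity keeps their ends distinct.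
  proper-hereditary : ∀ {k} {H : ColouredGraph (Fin k)} {S : Subset n} →
                      induced (G , γ) S ≅ H → Proper γ →
                      Proper (ColouredGraph.colouring H)
  proper-hereditary {k} {H} iso proper {i} {j} {l} e e′ j≢l eq =
    proper (proj₁ (lift e)) (proj₁ (lift e′))
      (λ fj≡fl → j≢l (f-injective fj≡fl))
      (trans (proj₂ (lift e)) (trans eq (sym (proj₂ (lift e′)))))
    where
    module H = ColouredGraph H
    open _≅_ iso
    open Inverse bijection using (to; from; strictlyInverseˡ)

    f : Fin k → Fin n
    f = proj₁ ∘ from

    f-injective : Injective _≡_ _≡_ f
    f-injective {x} {y} fx≡fy =
      trans (sym (strictlyInverseˡ x))
        (trans (cong to (proj₁-injective fx≡fy)) (strictlyInverseˡ y))

    lift : ∀ {x y} (d : x H.~ y) → Edge γ (H.colour d) (f x) (f y)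
    lift {x} {y} d = d″ , trans (preserves-colour {from x} {from y} d″ d′)
                                (colour-subst₂ H.colouring x≡ y≡ d)
      where
      x≡ = sym (strictlyInverseˡ x)
      y≡ = sym (strictlyInverseˡ y)
      d′ = subst₂ H._~_ x≡ y≡ d
      d″ = Equivalence.from (preserves-~ (from x) (from y)) d′

  improper⇒free : ∀ {k} {H : ColouredGraph (Fin k)} →
                  ¬ Proper (ColouredGraph.colouring H) → Proper γ →
                  ¬ ∃ λ S → induced (G , γ) S ≅ H
  improper⇒free improper proper (_ , iso) = improper (proper-hereditary iso proper)

  module _ {k} (H : ColouredGraph (Fin k)) (f : Fin k → Fin n)
           (f-injective : Injective _≡_ _≡_ f)
           (f-edge : ∀ i j (e : ColouredGraph._~_ H i j) →
                     Edge γ (ColouredGraph.colour H e) (f i) (f j))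
           (f-edge⁻¹ : ∀ i j → f i ~ f j → ColouredGraph._~_ H i j)
    where

    private
      preimage? : ∀ v → Dec (∃ λ i → f i ≡ v)
      preimage? v = any? λ i → f i ≟ v

      image : Subset n
      image = tabulate (does ∘ preimage?)

      preimage : ∀ {v} → v ∈ image → ∃ λ i → f i ≡ v
      -- The answer `no` would turn the accompanying equation into `false ≡ true`.
      preimage {v} v∈ with preimage? v
        | trans (sym (lookup∘tabulate (does ∘ preimage?) v)) ([]=⇒lookup v∈)
      ... | yes p | _ = p

      ∈-image : ∀ i → f i ∈ image
      ∈-image i = lookup⇒[]= (f i) image
        (trans (lookup∘tabulate (does ∘ preimage?) (f i))
               (dec-true (preimage? (f i)) (i , refl)))

    -- The image of `f` serves as vertex set, and each of its vertices is sent to its preimage,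
    -- which is unique by injectivity.
    embedding⇒induced : ∃ λ S → induced (G , γ) S ≅ H
    embedding⇒induced = image , record
      { bijection = mk↔ₛ′ to (λ i → f i , ∈-image i)
          (λ i → f-injective (f∘to (f i , ∈-image i)))
          λ p → proj₁-injective (f∘to p)
      ; preserves-~ = λ p q → mk⇔
          (λ e → f-edge⁻¹ _ _ (subst₂ _~_ (sym (f∘to p)) (sym (f∘to q)) e))
          (λ e → subst₂ _~_ (f∘to p) (f∘to q) (proj₁ (f-edge _ _ e)))
      ; preserves-colour = λ {p} {q} e e′ →
          trans (sym (colour-subst₂ γ (sym (f∘to p)) (sym (f∘to q)) e))
            (trans (colour-irrelevant γ _ _) (proj₂ (f-edge _ _ e′)))
      }
      where
      to : (∃ λ v → v ∈ image) → Fin k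
      to (_ , v∈) = proj₁ (preimage v∈)

      f∘to : ∀ p → f (to p) ≡ proj₁ p
      f∘to (_ , v∈) = proj₂ (preimage v∈)

  -- Induced paths and triangles on three vertices

  ~⇒≢ : ∀ {u v} → u ~ v → u ≢ v
  ~⇒≢ e u≡v = ~-irrefl u≡v e

  triple : Fin n → Fin n → Fin n → Fin 3 → Fin n
  triple x y z 0F = x
  triple x y z 1F = y
  triple x y z 2F = z

  triple-injective : ∀ {x y z} → x ≢ y → x ≢ z → y ≢ z →
                     Injective _≡_ _≡_ (triple x y z)
  triple-injective xy xz yz {0F} {0F} _  = refl
  triple-injective xy xz yz {0F} {1F} eq = contradiction eq xy
  triple-injective xy xz yz {0F} {2F} eq = contradiction eq xz
  triple-injective xy xz yz {1F} {0F} eq = contradiction (sym eq) xy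
  triple-injective xy xz yz {1F} {1F} _  = refl
  triple-injective xy xz yz {1F} {2F} eq = contradiction eq yz
  triple-injective xy xz yz {2F} {0F} eq = contradiction (sym eq) xz
  triple-injective xy xz yz {2F} {1F} eq = contradiction (sym eq) yz
  triple-injective xy xz yz {2F} {2F} _  = refl

  induced-P₃ : ∀ {a x y z} → Edge γ a x y → Edge γ a y z → x ≢ z → ¬ (x ~ z) →
               ∃ λ S → induced (G , γ) S ≅ proj₂ (P₃ a)
  induced-P₃ {a} {x} {y} {z} xy yz x≢z x≁z = embedding⇒induced (proj₂ (P₃ a)) f
    (triple-injective (~⇒≢ (proj₁ xy)) x≢z (~⇒≢ (proj₁ yz))) edge edge⁻¹
    where
    f = triple x y z
    open Graph path₃ using () renaming (_~_ to _≈_)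

    edge : ∀ i j → i ≈ j → Edge γ a (f i) (f j)
    edge 0F 1F _ = xy
    edge 1F 0F _ = Edge-sym γ xy
    edge 1F 2F _ = yz
    edge 2F 1F _ = Edge-sym γ yz
    edge 2F 2F ()

    edge⁻¹ : ∀ i j → f i ~ f j → i ≈ j
    edge⁻¹ 0F 0F e = contradiction e (~-irrefl refl)
    edge⁻¹ 0F 1F e = refl
    edge⁻¹ 0F 2F e = contradiction e x≁z
    edge⁻¹ 1F 0F e = refl
    edge⁻¹ 1F 1F e = contradiction e (~-irrefl refl)
    edge⁻¹ 1F 2F e = refl
    edge⁻¹ 2F 0F e = contradiction (~-sym e) x≁z
    edge⁻¹ 2F 1F e = refl
    edge⁻¹ 2F 2F e = contradiction e (~-irrefl refl)

  induced-K₃ : ∀ {a b c x y z} → Edge γ a x y → Edge γ b x z → Edge γ c y z →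
               ∃ λ S → induced (G , γ) S ≅ proj₂ (K₃ a b c)
  induced-K₃ {a} {b} {c} {x} {y} {z} xy xz yz = embedding⇒induced H f
    (triple-injective (~⇒≢ (proj₁ xy)) (~⇒≢ (proj₁ xz)) (~⇒≢ (proj₁ yz)))
    edge (λ i j e i≡j → ~-irrefl (cong f i≡j) e)
    where
    f = triple x y z
    H = proj₂ (K₃ a b c)
    module H = ColouredGraph H

    edge : ∀ i j (e : i H.~ j) → Edge γ (H.colour e) (f i) (f j)
    edge 0F 0F e = contradiction refl e
    edge 0F 1F e = xy
    edge 0F 2F e = xz
    edge 1F 0F e = Edge-sym γ xy
    edge 1F 1F e = contradiction refl e
    edge 1F 2F e = yz
    edge 2F 0F e = Edge-sym γ xz
    edge 2F 1F e = Edge-sym γ yz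
    edge 2F 2F e = contradiction refl e

  -- Two edges of one colour at `u` form an induced monochromatic path unless their ends are
  -- adjacent. The second hypothesis excludes this; it comes either from the triangle patterns or
  -- from a bipartition.
  P₃-free⇒proper : Free P₃s (G , γ) →
                   (∀ {a u v w} → Edge γ a u v → Edge γ a u w → ¬ (v ~ w)) →
                   Proper γ
  P₃-free⇒proper (rP ∷ bP ∷ []) no-triangle e e′ v≢w eq =
    no-P₃ (colour e) (induced-P₃ (Edge-sym γ (e , refl)) (e′ , sym eq) v≢w
                       (no-triangle (e , refl) (e′ , sym eq)))
    where
    no-P₃ : ∀ a → ¬ ∃ λ S → induced (G , γ) S ≅ proj₂ (P₃ a)
    no-P₃ red  = rP
    no-P₃ blue = bP

  free⇒proper : Free allPatterns (G , γ) → Proper γ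
  free⇒proper (rP ∷ bP ∷ rK ∷ bK ∷ rrbK ∷ rbbK ∷ []) =
    P₃-free⇒proper (rP ∷ bP ∷ []) λ p q e → no-triangle p q (e , refl)
    where
    no-triangle : ∀ {a b u v w} → Edge γ a u v → Edge γ a u w → ¬ Edge γ b v w
    no-triangle {red}  {red}  uv uw vw = rK (induced-K₃ uv uw vw)
    no-triangle {red}  {blue} uv uw vw = rrbK (induced-K₃ uv uw vw)
    -- The pattern has its red edge between 0 and 1, so `u` takes the place of 2.
    no-triangle {blue} {red}  uv uw vw =
      rbbK (induced-K₃ vw (Edge-sym γ uv) (Edge-sym γ uw))
    no-triangle {blue} {blue} uv uw vw = bK (induced-K₃ uv uw vw)

  proper⇒free : Proper γ → Free allPatterns (G , γ)
  proper⇒free proper =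
      improper⇒free P₃-improper proper
    ∷ improper⇒free P₃-improper proper
    ∷ improper⇒free (λ p → p {0F} {1F} {2F} (λ ()) (λ ()) (λ ()) refl) proper
    ∷ improper⇒free (λ p → p {0F} {1F} {2F} (λ ()) (λ ()) (λ ()) refl) proper
    ∷ improper⇒free (λ p → p {0F} {1F} {2F} (λ ()) (λ ()) (λ ()) refl) proper
    -- Here the two blue edges meet at vertex 2; in the other triangles two equally coloured edges
    -- meet at 0.
    ∷ improper⇒free (λ p → p {2F} {0F} {1F} (λ ()) (λ ()) (λ ()) refl) proper
    ∷ []
    where
    P₃-improper : ∀ {a} → ¬ Proper (ColouredGraph.colouring (proj₂ (P₃ a)))
    P₃-improper p = p {1F} {0F} {2F} refl refl (λ ()) refl

  bipartite⇒proper : Bipartite G → Free P₃s (G , γ) → Proper γ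
  bipartite⇒proper (side , differ) free =
    P₃-free⇒proper free λ (uv , _) (uw , _) vw →
      pigeonhole (differ uv) (differ uw) (differ vw)
    where
    pigeonhole : ∀ {x y z : Bool} → x ≢ y → x ≢ z → y ≢ z → ⊥
    pigeonhole {false} {false} {_}     p q r = p refl
    pigeonhole {false} {true}  {false} p q r = q refl
    pigeonhole {false} {true}  {true}  p q r = r refl
    pigeonhole {true}  {true}  {_}     p q r = p refl
    pigeonhole {true}  {false} {true}  p q r = q refl
    pigeonhole {true}  {false} {false} p q r = r refl

-- Alternating walks

module _ {n} {G : Graph (Fin n)} (γ : EdgeColouring G Colour) (proper : Proper γ) where
  open Graph G
  open EdgeColouring γ

  -- Properness as determinism; matching the resulting equality with `refl` is what cancels a
  -- retraced edge.
  Edge-functional : ∀ {a u v w} → Edge γ a u v → Edge γ a u w → v ≡ w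
  Edge-functional {v = v} {w} (e , p) (e′ , q) with v ≟ w
  ... | yes v≡w = v≡w
  ... | no  v≢w = contradiction (trans p (sym q)) (proper e e′ v≢w)

  -- An alternating walk of odd length begins and ends with the same colour `a`. It is built from
  -- the middle outwards, so that both end edges can be stripped together.
  data OddWalk (a : Colour) (u v : Fin n) : Set where
    single : Edge γ a u v → OddWalk a u v
    wrap   : ∀ {x y} → Edge γ a u x → OddWalk (opposite a) x y → Edge γ a y v →
             OddWalk a u v

  odd-not-closed : ∀ {a u} → ¬ OddWalk a u u
  odd-not-closed (single (e , _)) = ~-irrefl refl e
  odd-not-closed (wrap e p e′) with refl ← Edge-functional e (Edge-sym γ e′) =
    odd-not-closed p

  EvenWalk : Colour → Fin n → Fin n → Set
  EvenWalk a u v = ∃ λ x → Edge γ a u x × OddWalk (opposite a) x v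

  -- An even walk splits as an odd walk and a last edge, or as a first edge and an odd walk.
  -- `uncons` and `unsnoc` pass between the two forms, since `OddWalk` grows at both ends but `cons`
  -- changes only the front.
  uncons : ∀ {a u v w} → OddWalk a u v → Edge γ (opposite a) v w → EvenWalk a u w
  uncons (single e)     f = _ , e , single f
  uncons {a} (wrap e p e′) f
    with _ , d , q ← uncons p (subst (λ c → Edge γ c _ _) (sym (opposite-involutive a)) e′)
    = _ , e , wrap d q f

  unsnoc : ∀ {a u v w} → Edge γ a u v → OddWalk (opposite a) v w →
           ∃ λ x → OddWalk a u x × Edge γ (opposite a) x w
  unsnoc e (single f) = _ , single e , f
  unsnoc {a} e (wrap f p f′)
    with _ , q , d ← unsnoc f p
    = _ , wrap e q (subst (λ c → Edge γ c _ _) (opposite-involutive a) d) , f′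

  -- The index is true when the length is odd.
  data Alternating : Bool → Fin n → Fin n → Set where
    empty : ∀ {u} → Alternating false u u
    even  : ∀ {a u v} → EvenWalk a u v → Alternating false u v
    odd   : ∀ {a u v} → OddWalk a u v → Alternating true u v

  -- If the new edge has the colour of the first edge of the walk, it retraces that edge and both
  -- cancel; otherwise it extends the walk. The parity flips either way.
  cons : ∀ {p u v w} → u ~ v → Alternating p v w → Alternating (not p) u w
  -- Reversed, the new edge leaves `v` just as the walk does, as `Edge-functional` requires.
  cons {u = u} {v} e = go (~-sym e , refl)
    where
    go : ∀ {p c w} → Edge γ c v u → Alternating p v w → Alternating (not p) u w
    go d empty = odd (single (Edge-sym γ d))
    go {c = c} d (odd {a} p) with compare a c
    go d (odd (single f)) | same with refl ← Edge-functional d f = empty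
    go d (odd {a} (wrap f p f′)) | same with refl ← Edge-functional d f =
      even (uncons p (subst (λ c → Edge γ c _ _) (sym (opposite-involutive a)) f′))
    go d (odd {a} p) | opposing =
      even (_ , Edge-sym γ d , subst (λ c → OddWalk c _ _) (sym (opposite-involutive a)) p)
    go {c = c} d (even {a} p) with compare a c
    go d (even (_ , f , p)) | same with refl ← Edge-functional d f = odd p
    go d (even (_ , e′ , p)) | opposing with _ , q , f ← unsnoc e′ p =
      odd (wrap (Edge-sym γ d) (subst (λ c → OddWalk c _ _) (sym (opposite-involutive _)) q) f)

  -- Parity of walks

  parity : ∀ {u v} → Star _~_ u v → Bool
  parity ε       = false
  parity (_ ◅ w) = not (parity w)

  prepend : ∀ {p u v w} (s : Star _~_ u v) → Alternating p v w →
            Alternating (parity s xor p) u w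
  prepend ε r = r
  prepend (e ◅ s) r =
    subst (λ q → Alternating q _ _) (not-distribˡ-xor (parity s) _) (cons e (prepend s r))

  -- Prepending the edges from first to last traverses `s` backwards without forming the reversed
  -- walk.
  prepend-reverse : ∀ {p u v w} (s : Star _~_ u v) → Alternating p u w →
                    Alternating (parity s xor p) v w
  prepend-reverse ε r = r
  prepend-reverse {p} (e ◅ s) r =
    subst (λ q → Alternating q _ _)
      (trans (sym (not-distribʳ-xor (parity s) p)) (not-distribˡ-xor (parity s) p))
      (prepend-reverse s (cons (~-sym e) r))

  alternating-true-not-closed : ∀ {u} → ¬ Alternating true u u
  alternating-true-not-closed (odd p) = odd-not-closed p

  -- Following `s`, then `t` backwards, then the edge back to `u` gives a closed walk, which is odd
  -- if the parities agree.
  parity-differ : ∀ {u v r} → u ~ v → (s : Star _~_ u r) (t : Star _~_ v r) →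
                  parity s ≢ parity t
  parity-differ e s t eq = alternating-true-not-closed
    (subst (λ q → Alternating q _ _) (xor-true (parity s) (parity t) eq)
      (prepend s (prepend-reverse t (cons (~-sym e) empty))))
    where
    xor-true : ∀ x y → x ≡ y → x xor (y xor true) ≡ true
    xor-true false false _ = refl
    xor-true true  true  _ = refl

-- Connected components

module _ {n} (G : Graph (Fin n)) where
  open Graph G

  -- Invariant of a union-find pass: only the adjacent pairs listed in `es` are required to share a
  -- root so far.
  Rooted : List (Fin n × Fin n) → Set
  Rooted es = ∃ λ (root : Fin n → Fin n) →
    (∀ x → Star _~_ x (root x)) × All (λ (u , v) → u ~ v → root u ≡ root v) es

  rooted : ∀ es → Rooted es
  rooted [] = id , (λ _ → ε) , []
  rooted ((u , v) ∷ es) with rooted es | u ~? v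
  ... | root , path , joined | no  u≁v = root , path , (λ e → contradiction e u≁v) ∷ joined
  ... | root , path , joined | yes e   =
    -- Since `merge` is applied after `root`, equalities between earlier roots survive by
    -- congruence.
    merge ∘ root , (λ x → path x ◅◅ walk (root x)) ,
    (λ _ → merged) ∷ All.map (λ eq d → cong merge (eq d)) joined
    where
    merge : Fin n → Fin n
    merge y with y ≟ root u
    ... | yes _ = root v
    ... | no  _ = y

    walk : ∀ y → Star _~_ y (merge y)
    walk y with y ≟ root u
    -- From the old root back to `u`, across the edge, then on to the root of `v`.
    ... | yes refl = reverse ~-sym (path u) ◅◅ e ◅ path v
    ... | no  _    = ε

    merged : merge (root u) ≡ merge (root v)
    merged with root u ≟ root u | root v ≟ root u
    ... | yes _ | yes _ = refl
    ... | yes _ | no  _ = refl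
    ... | no ¬p | _     = contradiction refl ¬p

  components : ∃ λ (root : Fin n → Fin n) →
    (∀ x → Star _~_ x (root x)) × (∀ {u v} → u ~ v → root u ≡ root v)
  components with root , path , joined ← rooted (cartesianProduct (allFin n) (allFin n)) =
    root , path , λ {u} {v} →
      All.lookup joined (∈-cartesianProduct⁺ (∈-allFin u) (∈-allFin v))

  proper⇒bipartite : (γ : EdgeColouring G Colour) → Proper γ → Bipartite G
  proper⇒bipartite γ proper with root , path , joined ← components =
    (λ x → parity γ proper (path x)) ,
    λ {u} {v} e → differ e (path u) (path v) (joined e)
    where
    -- The roots become variables so that their equality can be matched with `refl`.
    differ : ∀ {u v r r′} → u ~ v → (s : Star _~_ u r) (t : Star _~_ v r′) → r ≡ r′ →
             parity γ proper s ≢ parity γ proper t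
    differ e s t refl = parity-differ γ proper e s t

-- Edge-chromatic index

module _ {n} {G : Graph (Fin n)} where
  open Graph G

  -- The exact index has to be exhibited, and a finite search finds it: 0 without edges, 1 if there
  -- are edges but no two share a vertex, and 2 otherwise.
  colourable⇒index≤2 : ProperlyEdgeColourable G 2 → EdgeChromaticIndexAtMost G 2
  colourable⇒index≤2 (γ , proper)
    with any? (λ u → any? λ v → u ~? v)
  ... | no no-edge =
    0 , ((record { colour     = λ e → contradiction (_ , _ , e) no-edge
                 ; colour-sym = λ e _ → contradiction (_ , _ , e) no-edge }
         , λ e _ _ _ → no-edge (_ , _ , e)) , λ _ _ → z≤n) , z≤n
  ... | yes (_ , _ , d)
    with any? (λ u → any? λ v → any? λ w → (u ~? v) ×-dec (u ~? w) ×-dec ¬? (v ≟ w))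
  ... | no no-cherry =
    1 , ((record { colour = λ _ → 0F ; colour-sym = λ _ _ → refl }
         , λ e e′ v≢w _ → no-cherry (_ , _ , _ , e , e′ , v≢w)) , minimal) , s≤s z≤n
    where
    minimal : ∀ m → ProperlyEdgeColourable G m → 1 ≤ m
    minimal 0 (δ , _) with () ← EdgeColouring.colour δ d
    minimal (ℕ.suc _) _ = s≤s z≤n
  ... | yes (_ , _ , _ , e , e′ , v≢w) = 2 , ((γ , proper) , minimal) , ≤-refl
    where
    Fin1-unique : (i j : Fin 1) → i ≡ j
    Fin1-unique 0F 0F = refl

    minimal : ∀ m → ProperlyEdgeColourable G m → 2 ≤ m
    minimal 0 (δ , _) with () ← EdgeColouring.colour δ d
    minimal 1 (δ , δ-proper) = contradiction (Fin1-unique _ _) (δ-proper e e′ v≢w)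
    minimal (ℕ.suc (ℕ.suc _)) _ = s≤s (s≤s z≤n)

  index≤2⇔proper : EdgeChromaticIndexAtMost G 2 ⇔ ∃ λ (γ : EdgeColouring G Colour) → Proper γ
  index≤2⇔proper = mk⇔
    (λ (_ , ((γ , proper) , _) , k≤2) →
      recolour (λ i → decode (inject≤ i k≤2)) γ ,
      recolour-proper γ (inject≤-injective k≤2 k≤2 _ _ ∘ decode-injective) proper)
    (λ (γ , proper) →
      colourable⇒index≤2 (recolour encode γ , recolour-proper γ encode-injective proper))
    where
    decode : Fin 2 → Colour
    decode 0F = red
    decode 1F = blue

    encode : Colour → Fin 2
    encode red  = 0F
    encode blue = 1F

    decode-injective : Injective _≡_ _≡_ decode
    decode-injective {0F} {0F} _ = refl
    decode-injective {0F} {1F} ()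
    decode-injective {1F} {0F} ()
    decode-injective {1F} {1F} _ = refl

    encode-injective : Injective _≡_ _≡_ encode
    encode-injective {red}  {red}  _ = refl
    encode-injective {blue} {blue} _ = refl

proposition14 : (n : ℕ) (G : Graph (Fin n)) →
    ((Bipartite G × Elementary G) ⇔ EdgeChromaticIndexAtMost G 2)
    × (EdgeChromaticIndexAtMost G 2 ⇔
    AdmitsFree (ʳP₃ ∷ ᵇP₃ ∷ ʳK₃ ∷ ᵇK₃ ∷ ʳʳᵇK₃ ∷ ʳᵇᵇK₃ ∷ []) G)
proposition14 n G =
  -- Both equivalences pass through a proper red-blue colouring; the same one yields the bipartition
  -- and the freeness.
  mk⇔ (λ (bip , γ , free) → from (γ , bipartite⇒proper {γ = γ} bip free))
      (λ index → case to index of λ (γ , proper) →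
        proper⇒bipartite G γ proper , γ , P₃-free γ (proper⇒free {γ = γ} proper)) ,
  mk⇔ (λ index → case to index of λ (γ , proper) → γ , proper⇒free {γ = γ} proper)
      (λ (γ , free) → from (γ , free⇒proper {γ = γ} free))
  where
  open Equivalence (index≤2⇔proper {G = G})

  P₃-free : ∀ γ → Free allPatterns (G , γ) → Free P₃s (G , γ)
  P₃-free γ (rP ∷ bP ∷ _) = rP ∷ bP ∷ []
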